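{- Let $b$ be a graph over $(X,m)$. For any $p\in[1,\infty)$ and any function $d:X\times X\to[0,\infty)$ with $\delta(d)>0$, we have $$\lambda^{(0)}_{p}\leq\frac{h^{(0)}(d)}{\delta(d)}.$$
   Context: Setting: $X$ is a nonempty countable (finite or infinite) set, $C(X)$ is the space of real-valued functions on $X$ and $C_c(X)$ the subspace of finitely supported functions. A graph $b$ over $(X,m)$ consists of a symmetric function $b:X\times X\to[0,\infty)$ with $b(x,x)=0$ and $\sum_{y\in X}b(x,y)<\infty$ for all $x\in X$, and a function $m:X\to(0,\infty)$, extended to a measure on subsets by $m(W)=\sum_{x\in W}m(x)$. $\|f\|_{m,p}=\bigl(\sum_{x\in X}|f(x)|^p m(x)\bigr)^{1/p}$. Energy: $\mathcal{E}_p(f)=\frac12\sum_{x,y\in X}b(x,y)|f(x)-f(y)|^p\in[0,\infty]$ for $f\in C(X)$, and $$\lambda^{(0)}_p=\inf_{0\neq\varphi\in C_c(X)}\frac{\mathcal{E}_p(\varphi)}{\|\varphi\|_{m,p}^p}.$$ For $W\subseteq X$, $\partial W=W\times(X\setminus W)$, and for $d:X\times X\to[0,\infty)$, $|\partial W|_{bd}=\sum_{(x,y)\in\partial W}b(x,y)d(x,y)\in[0,\infty]$, $$h^{(0)}(d)=\inf_{\emptyset\ne W\subseteq X\text{ finite}}\frac{|\partial W|_{bd}}{m(W)},\qquad \delta(d)=\inf\{d(x,y): x,y\in X,\ b(x,y)>0\}.$$ Conventions: $\inf\emptyset=+\infty$ and $a/(+\infty)=0$ for $a\in[0,\infty)$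 (relevant only if $b\equiv0$). -}

module Defs where

open import Algebra.Definitions.RawSemiring using () renaming (_^_ to power)
open import Data.Integer.Base using (+_)
open import Data.List.Base using (List; []; foldr; map)
open import Data.List.Membership.Propositional using (_∈_; _∉_)
open import Data.List.Relation.Unary.All using (All)
open import Data.List.Relation.Unary.Unique.Propositional using (Unique)
open import Data.Nat.Base using (ℕ; suc)
open import Data.Product.Base using (Σ-syntax; ∃-syntax; _×_; _,_)
open import Data.Rational.Base as ℚ using (ℚ; 0ℚ; 1ℚ; ½)
open import Data.Sum.Base using (_⊎_)
open import Level using (Level; 0ℓ; _⊔_) renaming (suc to lsuc)
open import Relation.Binary.PropositionalEquality.Core using (_≢_)
open import Relation.Nullary.Negation.Core using (¬_)
open import Relation.Unary using (Pred; U)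

private
  variable
    a c r : Level

------------------------------------------------------------------------
-- Extended real numbers

-- An extended real x ∈ [-∞,∞] is represented by its two-sided Dedekind
-- cut: `lower x q` means q < x and `upper x q` means x < q.  The cut
-- conditions are only imposed on real numbers (`ℝ` below).  Classically,
-- every operation below takes cuts of extended reals in its stated domain
-- to the cut of the expected extended real; ∞ has an empty upper part.
record Cut (a : Level) : Set (lsuc a) where
  constructor mkCut
  field
    lower : Pred ℚ a
    upper : Pred ℚ a

open Cut public

infix 4 _<_ _≤_ _≃_

_<_ : Cut a → Cut c → Set (a ⊔ c)
x < y = ∃[ q ] upper x q × lower y q

-- The usual order of constructive analysis: x ≤ y is the negation of y < x.
_≤_ : Cut a → Cut c → Set (a ⊔ c)
x ≤ y = ¬ (y < x)

_≃_ : Cut a → Cut c → Set (a ⊔ c)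
x ≃ y = x ≤ y × y ≤ x

-- x < ∞
Finite : Cut a → Set a
Finite x = ∃[ q ] upper x q

record IsReal (x : Cut a) : Set a where
  field
    lower-inhabited : ∃[ q ] lower x q
    upper-inhabited : ∃[ q ] upper x q
    lower-closed    : ∀ {q s} → q ℚ.< s → lower x s → lower x q
    upper-closed    : ∀ {q s} → q ℚ.< s → upper x q → upper x s
    lower-open      : ∀ {q} → lower x q → ∃[ s ] q ℚ.< s × lower x s
    upper-open      : ∀ {q} → upper x q → ∃[ s ] s ℚ.< q × upper x s
    disjoint        : ∀ {q} → lower x q → ¬ upper x q
    located         : ∀ {q s} → q ℚ.< s → lower x q ⊎ upper x s

record ℝ : Set₁ where
  constructor mkℝ
  field
    cut    : Cut 0ℓ
    isReal : IsReal cut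

open ℝ public

------------------------------------------------------------------------
-- Arithmetic

fromℚ : ℚ → Cut 0ℓ
fromℚ x = mkCut (ℚ._< x) (x ℚ.<_)

𝟎 𝟏 : Cut 0ℓ
𝟎 = fromℚ 0ℚ
𝟏 = fromℚ 1ℚ

infixl 6 _+_ _-_
infixl 7 _*_ _/_
infixr 8 _^_

_+_ : Cut a → Cut c → Cut (a ⊔ c)
lower (x + y) q = ∃[ s ] ∃[ t ] lower x s × lower y t × q ℚ.≤ s ℚ.+ t
upper (x + y) q = ∃[ s ] ∃[ t ] upper x s × upper y t × s ℚ.+ t ℚ.≤ q

_-_ : Cut a → Cut c → Cut (a ⊔ c)
lower (x - y) q = ∃[ s ] ∃[ t ] lower x s × upper y t × q ℚ.≤ s ℚ.- t
upper (x - y) q = ∃[ s ] ∃[ t ] upper x s × lower y t × s ℚ.- t ℚ.≤ q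

∣_∣ : Cut a → Cut a
lower ∣ x ∣ q = lower x q ⊎ upper x (ℚ.- q)
upper ∣ x ∣ q = upper x q × lower x (ℚ.- q)

-- For x, y ∈ [0,∞], excluding 0 * ∞.
_*_ : Cut a → Cut c → Cut (a ⊔ c)
lower (x * y) q = q ℚ.< 0ℚ ⊎
  (∃[ s ] ∃[ t ] (0ℚ ℚ.≤ s × lower x s) × (0ℚ ℚ.≤ t × lower y t) × q ℚ.≤ s ℚ.* t)
upper (x * y) q = ∃[ s ] ∃[ t ] upper x s × upper y t × s ℚ.* t ℚ.≤ q

-- For x ∈ [0,∞] and y ∈ (0,∞], excluding ∞ / ∞; in particular x / ∞ is 0
-- for finite x.
_/_ : Cut a → Cut c → Cut (a ⊔ c)
lower (x / y) q = q ℚ.< 0ℚ ⊎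
  (∃[ s ] ∃[ t ] lower x s × upper y t × q ℚ.* t ℚ.≤ s)
upper (x / y) q = ∃[ s ] ∃[ t ] upper x s × (0ℚ ℚ.< t × lower y t) × s ℚ.≤ q ℚ.* t

infixr 8 _^ℕ_

_^ℕ_ : ℚ → ℕ → ℚ
_^ℕ_ = power ℚ.+-*-rawSemiring

-- For x ∈ [0,∞] and an exponent p ∈ (0,∞).  With e = k/n rational, the
-- rational bound s^e on x^p is a lower bound if s < x and s^e ≤ s^p, i.e.
-- e < p for s ≥ 1 and e > p for s ≤ 1, and dually for upper bounds.  The
-- comparison of q with s^(k/n) is expressed as that of q^n with s^k.
_^_ : Cut a → Cut c → Cut (a ⊔ c)
lower (x ^ p) q = q ℚ.< 0ℚ ⊎
  (∃[ s ] ∃[ k ] ∃[ n ] 0ℚ ℚ.≤ s × lower x s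
    × ((1ℚ ℚ.≤ s × lower p (+ k ℚ./ suc n)) ⊎ (s ℚ.≤ 1ℚ × upper p (+ k ℚ./ suc n)))
    × q ^ℕ suc n ℚ.≤ s ^ℕ k)
upper (x ^ p) q = 0ℚ ℚ.≤ q ×
  (∃[ s ] ∃[ k ] ∃[ n ] upper x s
    × ((1ℚ ℚ.≤ s × upper p (+ k ℚ./ suc n)) ⊎ (s ℚ.≤ 1ℚ × lower p (+ k ℚ./ suc n)))
    × s ^ℕ k ℚ.≤ q ^ℕ suc n)

------------------------------------------------------------------------
-- Suprema, infima and series

⨆ : {I : Set r} → (I → Cut a) → Cut (r ⊔ a)
lower (⨆ f) q = ∃[ i ] lower (f i) q
upper (⨆ f) q = ∃[ s ] s ℚ.< q × (∀ i → upper (f i) s)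

-- The infimum of the empty family is ∞.
⨅ : {I : Set r} → (I → Cut a) → Cut (r ⊔ a)
lower (⨅ f) q = ∃[ s ] q ℚ.< s × (∀ i → lower (f i) s)
upper (⨅ f) q = ∃[ i ] upper (f i) q

∑-list : {A : Set r} → List A → (A → Cut 0ℓ) → Cut 0ℓ
∑-list xs f = foldr _+_ 𝟎 (map f xs)

-- The sum in [0,∞] of the nonnegative f over the elements satisfying P:
-- the supremum of the sums over finite sets of such elements.
∑ : {A : Set r} → Pred A c → (A → Cut 0ℓ) → Cut (r ⊔ c)
∑ {A = A} P f =
  ⨆ {I = Σ[ xs ∈ List A ] Unique xs × All P xs} (λ (xs , _) → ∑-list xs f)

------------------------------------------------------------------------
-- Graphs

record Graph (X : Set) (m : X → ℝ) : Set₁ where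
  field
    b           : X → X → ℝ
    nonnegative : ∀ x y → 𝟎 ≤ cut (b x y)
    symmetric   : ∀ x y → cut (b x y) ≃ cut (b y x)
    loopless    : ∀ x → cut (b x x) ≃ 𝟎
    summable    : ∀ x → Finite (∑ U (λ y → cut (b x y)))

  measure : Pred X 0ℓ → Cut 0ℓ
  measure W = ∑ W (λ x → cut (m x))

  -- ‖ f ‖[ p ] is the norm ‖f‖_{m,p}.
  ‖_‖[_] : (X → ℝ) → ℝ → Cut 0ℓ
  ‖ f ‖[ p ] = (∑ U (λ x → ∣ cut (f x) ∣ ^ cut p * cut (m x))) ^ (𝟏 / cut p)

  energy : ℝ → (X → ℝ) → Cut 0ℓ
  energy p f = fromℚ ½ *
    ∑ U (λ ((x , y) : X × X) → cut (b x y) * ∣ cut (f x) - cut (f y) ∣ ^ cut p)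

  FinitelySupported : (X → ℝ) → Set
  FinitelySupported f = Σ[ S ∈ List X ] (∀ x → x ∉ S → cut (f x) ≃ 𝟎)

  Nonzero : (X → ℝ) → Set
  Nonzero f = ¬ (∀ x → cut (f x) ≃ 𝟎)

  -- λ_p^{(0)}
  λ⁰ : ℝ → Cut (lsuc 0ℓ)
  λ⁰ p = ⨅ {I = Σ[ φ ∈ (X → ℝ) ] FinitelySupported φ × Nonzero φ}
    (λ (φ , _) → energy p φ / ‖ φ ‖[ p ] ^ cut p)

  -- |∂W|_{bd}, where ∂W is W × (X ∖ W).
  boundary : (X → X → ℝ) → Pred X 0ℓ → Cut 0ℓ
  boundary d W =
    ∑ (λ ((x , y) : X × X) → W x × ¬ W y) (λ (x , y) → cut (b x y) * cut (d x y))

  -- h^{(0)}(d); a finite subset W of X is given by a list of its elements.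
  h⁰ : (X → X → ℝ) → Cut 0ℓ
  h⁰ d = ⨅ {I = Σ[ W ∈ List X ] W ≢ []}
    (λ (W , _) → boundary d (_∈ W) / measure (_∈ W))

  δ : (X → X → ℝ) → Cut 0ℓ
  δ d = ⨅ {I = Σ[ (x , y) ∈ X × X ] 𝟎 < cut (b x y)}
    (λ ((x , y) , _) → cut (d x y))

{-# OPTIONS --safe #-}
module Submission where

-- Test the infimum defining λ⁰ with the indicator φ of a finite set W.  Its
-- p-th powers are 0 or 1, so the norm of φ to the p is m(W), while an edge
-- contributes to the energy only if it joins W to its complement.  There
-- d(x,y) ≥ δ(d), so δ(d) times the energy is at most |∂W|: the factor ½
-- compensates for the two orientations of each edge.
--
-- The inequality to be proved is the negation of a strict one, so one has to
-- refute a rational q with h⁰/δ < q < λ⁰.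

open import Defs
open import Algebra.Bundles using (CommutativeRing)
open import Data.Bool.Base using (if_then_else_)
open import Data.Empty using (⊥)
open import Data.Integer.Base as ℤ using (+_)
open import Data.Integer.Properties as ℤ using ()
open import Data.List.Base using (List; []; _∷_; filter; map)
open import Data.List.Membership.Propositional using (_∈_; _∉_)
open import Data.List.Properties using (filter-accept; filter-reject)
open import Data.List.Relation.Unary.All as All using (All; []; _∷_)
open import Data.List.Relation.Unary.All.Properties using (all-filter)
open import Data.List.Relation.Unary.AllPairs.Core using ([])
open import Data.List.Relation.Unary.Any using (here)
open import Data.List.Relation.Unary.Unique.Propositional.Properties using (filter⁺; map⁺)
open import Data.Nat.Base as ℕ using (ℕ; zero; suc)
open import Data.Nat.Properties as ℕ using ()
open import Data.Product.Base using (∃-syntax; _×_; _,_; proj₁; swap)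
open import Data.Rational.Base as ℚ using (ℚ; 0ℚ; 1ℚ; ½)
open import Data.Rational.Properties as ℚ using ()
open import Data.Rational.Solver using (module +-*-Solver)
open import Data.Rational.Unnormalised.Base as ℚᵘ using (mkℚᵘ)
open import Data.Rational.Unnormalised.Properties as ℚᵘ using ()
open import Data.Sum.Base using (_⊎_; inj₁; inj₂)
open import Function.Base using (_∘_)
open import Function.Bundles using (_↣_)
open import Level using (Level; 0ℓ)
open import Relation.Binary.Definitions using (DecidableEquality; tri<; tri≈; tri>)
open import Relation.Binary.PropositionalEquality
open import Relation.Nullary.Decidable using (yes; no; does; ¬?; _×-dec_; via-injection; from-yes)
open import Relation.Nullary.Negation using (¬_; contradiction)
open import Relation.Unary using (Pred; Decidable; U)
import Algebra.Properties.CommutativeSemigroup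
import Algebra.Properties.Group
import Algebra.Properties.Semiring.Exp as Exp
import Data.List.Membership.DecPropositional as DecMembership

private
  variable
    a c : Level
    x y z w : ℚ

-- Rational arithmetic

0<1 : 0ℚ ℚ.< 1ℚ
0<1 = from-yes (0ℚ ℚ.<? 1ℚ)

0≤1 : 0ℚ ℚ.≤ 1ℚ
0≤1 = ℚ.<⇒≤ 0<1

*-monoˡ-≤ : 0ℚ ℚ.≤ x → y ℚ.≤ z → x ℚ.* y ℚ.≤ x ℚ.* z
*-monoˡ-≤ {x} 0≤x = ℚ.*-monoˡ-≤-nonNeg x {{ℚ.nonNegative 0≤x}}

*-monoʳ-≤ : 0ℚ ℚ.≤ x → y ℚ.≤ z → y ℚ.* x ℚ.≤ z ℚ.* x
*-monoʳ-≤ {x} 0≤x = ℚ.*-monoʳ-≤-nonNeg x {{ℚ.nonNegative 0≤x}}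

*-mono-≤ : 0ℚ ℚ.≤ x → 0ℚ ℚ.≤ w → x ℚ.≤ y → z ℚ.≤ w → x ℚ.* z ℚ.≤ y ℚ.* w
*-mono-≤ 0≤x 0≤w x≤y z≤w = ℚ.≤-trans (*-monoˡ-≤ 0≤x z≤w) (*-monoʳ-≤ 0≤w x≤y)

*-nonNeg : 0ℚ ℚ.≤ x → 0ℚ ℚ.≤ y → 0ℚ ℚ.≤ x ℚ.* y
*-nonNeg {x} {y} 0≤x 0≤y = subst (ℚ._≤ x ℚ.* y) (ℚ.*-zeroʳ x) (*-monoˡ-≤ 0≤x 0≤y)

-- Bounds on a quotient of cuts have the form `x ≤ y * z`; this carries positivity from the
-- numerator to the quotient.
positive-of-product : 0ℚ ℚ.< x → 0ℚ ℚ.≤ z → x ℚ.≤ y ℚ.* z → 0ℚ ℚ.< y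
positive-of-product {x} {z} {y} 0<x 0≤z x≤yz =
  ℚ.*-cancelʳ-<-nonNeg z {{ℚ.nonNegative 0≤z}}
    (subst (ℚ._< y ℚ.* z) (sym (ℚ.*-zeroˡ z)) (ℚ.<-≤-trans 0<x x≤yz))

-- Serves as the induction step of `energy≤boundary`: the estimates for head and tail of a sum are
-- added.
*-distribˡ-+-≤ : ∀ {t s s₁ s₂ u v} → 0ℚ ℚ.≤ t → s ℚ.≤ s₁ ℚ.+ s₂ →
  t ℚ.* s₁ ℚ.≤ u → t ℚ.* s₂ ℚ.≤ v → u ℚ.+ v ℚ.≤ w → t ℚ.* s ℚ.≤ w
*-distribˡ-+-≤ {w} {t} {s} {s₁} {s₂} {u} {v} 0≤t s≤ ts₁≤u ts₂≤v u+v≤w = begin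
  t ℚ.* s                  ≤⟨ *-monoˡ-≤ 0≤t s≤ ⟩
  t ℚ.* (s₁ ℚ.+ s₂)        ≡⟨ ℚ.*-distribˡ-+ t s₁ s₂ ⟩
  t ℚ.* s₁ ℚ.+ t ℚ.* s₂    ≤⟨ ℚ.+-mono-≤ ts₁≤u ts₂≤v ⟩
  u ℚ.+ v                  ≤⟨ u+v≤w ⟩
  w                        ∎
  where open ℚ.≤-Reasoning

-- Powers of rationals

open Exp (CommutativeRing.semiring ℚ.+-*-commutativeRing) using (^-assocʳ)

^ℕ-nonNeg : ∀ n → 0ℚ ℚ.≤ x → 0ℚ ℚ.≤ x ^ℕ n
^ℕ-nonNeg zero    0≤x = 0≤1
^ℕ-nonNeg (suc n) 0≤x = *-nonNeg 0≤x (^ℕ-nonNeg n 0≤x)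

^ℕ-monoˡ-≤ : ∀ n → 0ℚ ℚ.≤ x → x ℚ.≤ y → x ^ℕ n ℚ.≤ y ^ℕ n
^ℕ-monoˡ-≤ zero    0≤x x≤y = ℚ.≤-refl
^ℕ-monoˡ-≤ (suc n) 0≤x x≤y =
  *-mono-≤ 0≤x (^ℕ-nonNeg n (ℚ.≤-trans 0≤x x≤y)) x≤y (^ℕ-monoˡ-≤ n 0≤x x≤y)

^ℕ-pos : ∀ n → 0ℚ ℚ.< x → 0ℚ ℚ.< x ^ℕ n
^ℕ-pos zero    0<x = 0<1
^ℕ-pos {x} (suc n) 0<x = subst (ℚ._< x ^ℕ suc n) (ℚ.*-zeroʳ x)
  (ℚ.*-monoʳ-<-pos x {{ℚ.positive 0<x}} (^ℕ-pos n 0<x))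

1^ℕ : ∀ n → 1ℚ ^ℕ n ≡ 1ℚ
1^ℕ zero    = refl
1^ℕ (suc n) = trans (ℚ.*-identityˡ _) (1^ℕ n)

1≤^ℕ : ∀ n → 1ℚ ℚ.≤ x → 1ℚ ℚ.≤ x ^ℕ n
1≤^ℕ {x} n 1≤x = subst (ℚ._≤ x ^ℕ n) (1^ℕ n) (^ℕ-monoˡ-≤ n 0≤1 1≤x)

^ℕ≤1 : ∀ n → 0ℚ ℚ.≤ x → x ℚ.≤ 1ℚ → x ^ℕ n ℚ.≤ 1ℚ
^ℕ≤1 {x} n 0≤x x≤1 = subst (x ^ℕ n ℚ.≤_) (1^ℕ n) (^ℕ-monoˡ-≤ n 0≤x x≤1)

-- If `y < x`, then `x ^ℕ n` is positive, and multiplying `y < x` by it contradicts the assumed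
-- order of the powers.
^ℕ-cancelˡ-≤ : ∀ n → 0ℚ ℚ.≤ y → x ^ℕ suc n ℚ.≤ y ^ℕ suc n → x ℚ.≤ y
^ℕ-cancelˡ-≤ {y} {x} n 0≤y xⁿ≤yⁿ = ℚ.≮⇒≥ λ y<x → ℚ.<-irrefl refl (begin-strict
  x ^ℕ suc n     ≤⟨ xⁿ≤yⁿ ⟩
  y ℚ.* y ^ℕ n   ≤⟨ *-monoˡ-≤ 0≤y (^ℕ-monoˡ-≤ n 0≤y (ℚ.<⇒≤ y<x)) ⟩
  y ℚ.* x ^ℕ n   <⟨ ℚ.*-monoˡ-<-pos (x ^ℕ n)
                      {{ℚ.positive (^ℕ-pos n (ℚ.≤-<-trans 0≤y y<x))}} y<x ⟩
  x ^ℕ suc n     ∎)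
  where open ℚ.≤-Reasoning

^ℕ≤1⇒≤1 : ∀ n → x ^ℕ suc n ℚ.≤ 1ℚ → x ℚ.≤ 1ℚ
^ℕ≤1⇒≤1 {x} n xⁿ≤1 = ^ℕ-cancelˡ-≤ n 0≤1 (subst (x ^ℕ suc n ℚ.≤_) (sym (1^ℕ (suc n))) xⁿ≤1)

1≤^ℕ⇒1≤ : ∀ n → 0ℚ ℚ.≤ x → 1ℚ ℚ.≤ x ^ℕ suc n → 1ℚ ℚ.≤ x
1≤^ℕ⇒1≤ {x} n 0≤x 1≤xⁿ = ^ℕ-cancelˡ-≤ n 0≤x (subst (ℚ._≤ x ^ℕ suc n) (sym (1^ℕ (suc n))) 1≤xⁿ)

^ℕ-monoʳ-≤ : ∀ {k n} → 1ℚ ℚ.≤ x → k ℕ.≤ n → x ^ℕ k ℚ.≤ x ^ℕ n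
^ℕ-monoʳ-≤ {n = n} 1≤x ℕ.z≤n = 1≤^ℕ n 1≤x
^ℕ-monoʳ-≤ 1≤x (ℕ.s≤s k≤n) = *-monoˡ-≤ (ℚ.≤-trans 0≤1 1≤x) (^ℕ-monoʳ-≤ 1≤x k≤n)

^ℕ-antiʳ-≤ : ∀ {k n} → 0ℚ ℚ.≤ x → x ℚ.≤ 1ℚ → k ℕ.≤ n → x ^ℕ n ℚ.≤ x ^ℕ k
^ℕ-antiʳ-≤ {n = n} 0≤x x≤1 ℕ.z≤n = ^ℕ≤1 n 0≤x x≤1
^ℕ-antiʳ-≤ 0≤x x≤1 (ℕ.s≤s k≤n) = *-monoˡ-≤ 0≤x (^ℕ-antiʳ-≤ 0≤x x≤1 k≤n)

-- Composition of the bounds x^(k/n) ≤ y and y^(k′/n′) ≤ z, cleared of roots.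
^ℕ-compose : ∀ k n k′ n′ → 0ℚ ℚ.≤ x → 0ℚ ℚ.≤ y →
  x ^ℕ k ℚ.≤ y ^ℕ n → y ^ℕ k′ ℚ.≤ z ^ℕ n′ → x ^ℕ (k ℕ.* k′) ℚ.≤ z ^ℕ (n′ ℕ.* n)
^ℕ-compose {x} {y} {z} k n k′ n′ 0≤x 0≤y xᵏ≤yⁿ yᵏ≤zⁿ = begin
  x ^ℕ (k ℕ.* k′)    ≡⟨ ^-assocʳ x k k′ ⟨
  (x ^ℕ k) ^ℕ k′     ≤⟨ ^ℕ-monoˡ-≤ k′ (^ℕ-nonNeg k 0≤x) xᵏ≤yⁿ ⟩
  (y ^ℕ n) ^ℕ k′     ≡⟨ ^-assocʳ y n k′ ⟩
  y ^ℕ (n ℕ.* k′)    ≡⟨ cong (y ^ℕ_) (ℕ.*-comm n k′) ⟩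
  y ^ℕ (k′ ℕ.* n)    ≡⟨ ^-assocʳ y k′ n ⟨
  (y ^ℕ k′) ^ℕ n     ≤⟨ ^ℕ-monoˡ-≤ n (^ℕ-nonNeg k′ 0≤y) yᵏ≤zⁿ ⟩
  (z ^ℕ n′) ^ℕ n     ≡⟨ ^-assocʳ z n′ n ⟩
  z ^ℕ (n′ ℕ.* n)    ∎
  where open ℚ.≤-Reasoning

-- Reduction to lowest terms hides `k` and `suc n`. In `ℚᵘ` they stay visible, so comparing a
-- product of fractions with 1 becomes a comparison of natural numbers.
toℚᵘ-fraction-* : ∀ k n k′ n′ →
  ℚ.toℚᵘ ((+ k ℚ./ suc n) ℚ.* (+ k′ ℚ./ suc n′)) ℚᵘ.≃ mkℚᵘ (+ k) n ℚᵘ.* mkℚᵘ (+ k′) n′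
toℚᵘ-fraction-* k n k′ n′ = ℚᵘ.≃-trans
  (ℚ.toℚᵘ-homo-* (+ k ℚ./ suc n) (+ k′ ℚ./ suc n′))
  (ℚᵘ.*-cong (ℚ.toℚᵘ-fromℚᵘ (mkℚᵘ (+ k) n)) (ℚ.toℚᵘ-fromℚᵘ (mkℚᵘ (+ k′) n′)))

1≤fraction-* : ∀ k n k′ n′ → 1ℚ ℚ.≤ (+ k ℚ./ suc n) ℚ.* (+ k′ ℚ./ suc n′) →
  suc n ℕ.* suc n′ ℕ.≤ k ℕ.* k′
1≤fraction-* k n k′ n′ 1≤ = ℤ.drop‿+≤+
  (subst₂ ℤ._≤_ (ℤ.*-identityˡ _) (trans (ℤ.*-identityʳ _) (sym (ℤ.pos-* k k′)))
    (ℚᵘ.drop-*≤* (ℚᵘ.≤-respʳ-≃ (toℚᵘ-fraction-* k n k′ n′) (ℚ.toℚᵘ-mono-≤ 1≤))))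

fraction-*≤1 : ∀ k n k′ n′ → (+ k ℚ./ suc n) ℚ.* (+ k′ ℚ./ suc n′) ℚ.≤ 1ℚ →
  k ℕ.* k′ ℕ.≤ suc n ℕ.* suc n′
fraction-*≤1 k n k′ n′ ≤1 = ℤ.drop‿+≤+
  (subst₂ ℤ._≤_ (trans (ℤ.*-identityʳ _) (sym (ℤ.pos-* k k′))) (ℤ.*-identityˡ _)
    (ℚᵘ.drop-*≤* (ℚᵘ.≤-respˡ-≃ (toℚᵘ-fraction-* k n k′ n′) (ℚ.toℚᵘ-mono-≤ ≤1))))

fraction-nonNeg : ∀ k n → 0ℚ ℚ.≤ + k ℚ./ suc n
fraction-nonNeg k n = ℚ.nonNegative⁻¹ _ {{ℚ.normalize-nonNeg k (suc n)}}

-- Real numbers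

lower<upper : {α : Cut a} → IsReal α → lower α x → upper α y → x ℚ.< y
lower<upper {x = x} {y = y} α l u with ℚ.<-cmp x y
... | tri< x<y _ _ = x<y
... | tri≈ _ refl _ = contradiction u (IsReal.disjoint α l)
... | tri> _ _ y<x =
  contradiction u (IsReal.disjoint α (IsReal.lower-closed α y<x l))

≤-refl : (α : ℝ) → cut α ≤ cut α
≤-refl α (_ , u , l) = IsReal.disjoint (isReal α) l u

-- Since `≤` only negates `<`, the bound is first moved strictly up inside `α`; locatedness of `β`
-- then decides, and the hypothesis excludes the wrong case.
lower-transfer : {α β : ℝ} → cut α ≤ cut β → lower (cut α) x → lower (cut β) x
lower-transfer {α = α} {β} α≤β l with IsReal.lower-open (isReal α) l
... | y , x<y , l′ with IsReal.located (isReal β) x<y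
... | inj₁ l″ = l″
... | inj₂ u  = contradiction (y , u , l′) α≤β

nonNeg-lower⇒pos : {α : ℝ} → 0ℚ ℚ.≤ x → lower (cut α) x → 𝟎 < cut α
nonNeg-lower⇒pos {α = α} 0≤x l with IsReal.lower-open (isReal α) l
... | y , x<y , l′ = y , ℚ.≤-<-trans 0≤x x<y , l′

upper-nonNeg : (α : Cut a) → 𝟎 ≤ α → upper α x → 0ℚ ℚ.≤ x
upper-nonNeg α 0≤α u = ℚ.≮⇒≥ λ x<0 → 0≤α (_ , u , x<0)

pos⇒upper-nonNeg : {α : ℝ} → 𝟎 < cut α → upper (cut α) x → 0ℚ ℚ.≤ x
pos⇒upper-nonNeg {α = α} (_ , 0<y , l) u =
  ℚ.<⇒≤ (ℚ.<-trans 0<y (lower<upper (isReal α) l u))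

-- One of the partial sums is over the empty list and equals 0.
∑-upper-pos : {A : Set a} {P : Pred A c} {f : A → Cut 0ℓ} → upper (∑ P f) x → 0ℚ ℚ.< x
∑-upper-pos (_ , r<x , u) = ℚ.<-trans (u ([] , [] , [])) r<x

x-1<x : ∀ x → x ℚ.- 1ℚ ℚ.< x
x-1<x x = subst (x ℚ.- 1ℚ ℚ.<_) (ℚ.+-identityʳ x)
  (ℚ.+-monoʳ-< x (from-yes (ℚ.- 1ℚ ℚ.<? 0ℚ)))

x<x+1 : ∀ x → x ℚ.< x ℚ.+ 1ℚ
x<x+1 x = subst (ℚ._< x ℚ.+ 1ℚ) (ℚ.+-identityʳ x) (ℚ.+-monoʳ-< x 0<1)

fromℚ-isReal : ∀ x → IsReal (fromℚ x)
fromℚ-isReal x = record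
  { lower-inhabited = _ , x-1<x x
  ; upper-inhabited = _ , x<x+1 x
  ; lower-closed    = ℚ.<-trans
  ; upper-closed    = λ q<s x<q → ℚ.<-trans x<q q<s
  ; lower-open      = ℚ.<-dense
  ; upper-open      = λ x<q → let s , x<s , s<q = ℚ.<-dense x<q in s , s<q , x<s
  ; disjoint        = ℚ.<-asym
  ; located         = located
  }
  where
  located : ∀ {q s} → q ℚ.< s → q ℚ.< x ⊎ x ℚ.< s
  located {q} q<s with q ℚ.<? x
  ... | yes q<x = inj₁ q<x
  ... | no  q≮x = inj₂ (ℚ.≤-<-trans (ℚ.≮⇒≥ q≮x) q<s)

-- Powers of real numbers

p≤∣p∣ : ∀ p → p ℚ.≤ ℚ.∣ p ∣
p≤∣p∣ p with ℚ.≤-total 0ℚ p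
... | inj₁ 0≤p = ℚ.≤-reflexive (sym (ℚ.0≤p⇒∣p∣≡p 0≤p))
... | inj₂ p≤0 = ℚ.≤-trans p≤0 (ℚ.0≤∣p∣ p)

lower-∣fromℚ-fromℚ∣ : ∀ x y → lower ∣ fromℚ x - fromℚ y ∣ z → z ℚ.< ℚ.∣ x ℚ.- y ∣
lower-∣fromℚ-fromℚ∣ {z} x y (inj₁ (s , t , s<x , y<t , z≤s-t)) = begin-strict
  z                ≤⟨ z≤s-t ⟩
  s ℚ.- t          <⟨ ℚ.+-mono-< s<x (ℚ.neg-antimono-< y<t) ⟩
  x ℚ.- y          ≤⟨ p≤∣p∣ (x ℚ.- y) ⟩
  ℚ.∣ x ℚ.- y ∣    ∎
  where open ℚ.≤-Reasoning
lower-∣fromℚ-fromℚ∣ {z} x y (inj₂ (s , t , x<s , t<y , s-t≤-z)) = begin-strict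
  z                      ≡⟨ ⁻¹-involutive z ⟨
  ℚ.- (ℚ.- z)            ≤⟨ ℚ.neg-antimono-≤ s-t≤-z ⟩
  ℚ.- (s ℚ.- t)          <⟨ ℚ.neg-antimono-< (ℚ.+-mono-< x<s (ℚ.neg-antimono-< t<y)) ⟩
  ℚ.- (x ℚ.- y)          ≤⟨ p≤∣p∣ (ℚ.- (x ℚ.- y)) ⟩
  ℚ.∣ ℚ.- (x ℚ.- y) ∣    ≡⟨ ℚ.∣-p∣≡∣p∣ (x ℚ.- y) ⟩
  ℚ.∣ x ℚ.- y ∣          ∎
  where
  open ℚ.≤-Reasoning
  open Algebra.Properties.Group ℚ.+-0-group using (⁻¹-involutive)

lower-^-≤1 : (α : Cut a) (p : Cut c) → (∀ {s} → lower α s → s ℚ.≤ 1ℚ) → lower (α ^ p) x → x ℚ.≤ 1ℚ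
lower-^-≤1 α p α≤1 (inj₁ x<0) = ℚ.≤-trans (ℚ.<⇒≤ x<0) 0≤1
lower-^-≤1 α p α≤1 (inj₂ (_ , k , n , 0≤s , l , _ , xⁿ≤sᵏ)) =
  ^ℕ≤1⇒≤1 n (ℚ.≤-trans xⁿ≤sᵏ (^ℕ≤1 k 0≤s (α≤1 l)))

lower-^-<0 : (α : Cut a) (p : Cut c) → (∀ {s} → lower α s → s ℚ.< 0ℚ) → lower (α ^ p) x → x ℚ.< 0ℚ
lower-^-<0 α p α<0 (inj₁ x<0) = x<0
lower-^-<0 α p α<0 (inj₂ (_ , _ , _ , 0≤s , l , _)) =
  contradiction (ℚ.≤-<-trans 0≤s (α<0 l)) (ℚ.<-irrefl refl)

1≤upper-^ : (α : Cut a) (p : Cut c) → (∀ {s} → upper α s → 1ℚ ℚ.≤ s) → upper (α ^ p) x → 1ℚ ℚ.≤ x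
1≤upper-^ α p 1≤α (0≤x , _ , k , n , u , _ , sᵏ≤xⁿ) =
  1≤^ℕ⇒1≤ n 0≤x (ℚ.≤-trans (1≤^ℕ k (1≤α u)) sᵏ≤xⁿ)


-- That is, α ≤ (α ^ (1/p)) ^ p.
upper-^-root : (α : Cut a) (p : ℝ) → (∀ {r} → upper α r → 0ℚ ℚ.≤ r) →
  upper ((α ^ (𝟏 / cut p)) ^ cut p) x → ∃[ r ] upper α r × r ℚ.≤ x
upper-^-root {x = x} α p α-nonNeg
  (0≤x , s , k , n , (0≤s , r , k′ , n′ , u , root , rᵏ≤sⁿ) , power , sᵏ≤xⁿ) =
  r , u , r≤x root power
  where
  0≤r : 0ℚ ℚ.≤ r
  0≤r = α-nonNeg u

  e e′ : ℚ
  e  = + k ℚ./ suc n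
  e′ = + k′ ℚ./ suc n′

  -- This is `r ^ (e′ * e) ≤ x` cleared of roots; it remains to compare `e′ * e` with 1.
  composed : r ^ℕ (k′ ℕ.* k) ℚ.≤ x ^ℕ (suc n ℕ.* suc n′)
  composed = ^ℕ-compose {z = x} k′ (suc n′) k (suc n) 0≤r 0≤s rᵏ≤sⁿ sᵏ≤xⁿ

  1≤s⇒1≤x : 1ℚ ℚ.≤ s → 1ℚ ℚ.≤ x
  1≤s⇒1≤x 1≤s = 1≤^ℕ⇒1≤ n 0≤x (ℚ.≤-trans (1≤^ℕ k 1≤s) sᵏ≤xⁿ)

  r≤x : (1ℚ ℚ.≤ r × upper (𝟏 / cut p) e′) ⊎ (r ℚ.≤ 1ℚ × lower (𝟏 / cut p) e′) →
        (1ℚ ℚ.≤ s × upper (cut p) e) ⊎ (s ℚ.≤ 1ℚ × lower (cut p) e) → r ℚ.≤ x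
  -- Here `e′ > 1/p` and `e > p`, so `e′ * e ≥ 1`, and raising `r ≥ 1` to this exponent does not
  -- decrease it. The number `n′ + n * suc n′` is the predecessor of `suc n * suc n′`.
  r≤x (inj₁ (1≤r , c , b , 1<c , (_ , b<p) , c≤e′b)) (inj₁ (_ , p<e)) =
    ^ℕ-cancelˡ-≤ (n′ ℕ.+ n ℕ.* suc n′) 0≤x (ℚ.≤-trans (^ℕ-monoʳ-≤ 1≤r exponents) composed)
    where
    exponents : suc n ℕ.* suc n′ ℕ.≤ k′ ℕ.* k
    exponents = subst (ℕ._≤ k′ ℕ.* k) (ℕ.*-comm (suc n′) (suc n))
      (1≤fraction-* k′ n′ k n (begin
        1ℚ          ≤⟨ ℚ.<⇒≤ 1<c ⟩
        c           ≤⟨ c≤e′b ⟩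
        e′ ℚ.* b    ≤⟨ *-monoˡ-≤ (fraction-nonNeg k′ n′) (ℚ.<⇒≤ (lower<upper (isReal p) b<p p<e)) ⟩
        e′ ℚ.* e    ∎))
      where open ℚ.≤-Reasoning
  -- Here 1 ≤ r and r ^ e′ ≤ s ≤ 1, so r = s = 1.
  r≤x (inj₁ (1≤r , c , b , 1<c , (0<b , _) , c≤e′b)) (inj₂ (s≤1 , _)) =
    ℚ.≤-trans (r≤1 k′ 0<e′ rᵏ≤sⁿ) (1≤s⇒1≤x (1≤^ℕ⇒1≤ n′ 0≤s (ℚ.≤-trans (1≤^ℕ k′ 1≤r) rᵏ≤sⁿ)))
    where
    0<e′ : 0ℚ ℚ.< e′
    0<e′ = positive-of-product (ℚ.<-trans 0<1 1<c) (ℚ.<⇒≤ 0<b) c≤e′b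
    -- The exponent is generalised in order to split on it: `k′ = 0` would say nothing about `r` and
    -- is excluded by `e′ > 0`.
    r≤1 : ∀ k′ → 0ℚ ℚ.< + k′ ℚ./ suc n′ → r ^ℕ k′ ℚ.≤ s ^ℕ suc n′ → r ℚ.≤ 1ℚ
    r≤1 zero 0<0 _ = contradiction (subst (0ℚ ℚ.<_) (ℚ.0/n≡0 (suc n′)) 0<0) (ℚ.<-irrefl refl)
    r≤1 (suc k′) _ rᵏ≤sⁿ = ^ℕ≤1⇒≤1 k′ (ℚ.≤-trans rᵏ≤sⁿ (^ℕ≤1 (suc n′) 0≤s s≤1))
  r≤x (inj₂ (r≤1 , _)) (inj₁ (1≤s , _)) = ℚ.≤-trans r≤1 (1≤s⇒1≤x 1≤s)
  r≤x (inj₂ (_ , inj₁ e′<0)) (inj₂ _) =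
    contradiction (ℚ.≤-<-trans (fraction-nonNeg k′ n′) e′<0) (ℚ.<-irrefl refl)
  -- Dually, `e′ < 1/p` and `e < p` give `e′ * e ≤ 1`, and powers of `r ≤ 1` do not increase with
  -- the exponent.
  r≤x (inj₂ (r≤1 , inj₂ (c , b , c<1 , p<b , e′b≤c))) (inj₂ (_ , e<p)) =
    ^ℕ-cancelˡ-≤ (n′ ℕ.+ n ℕ.* suc n′) 0≤x (ℚ.≤-trans (^ℕ-antiʳ-≤ 0≤r r≤1 exponents) composed)
    where
    exponents : k′ ℕ.* k ℕ.≤ suc n ℕ.* suc n′
    exponents = subst (k′ ℕ.* k ℕ.≤_) (ℕ.*-comm (suc n′) (suc n))
      (fraction-*≤1 k′ n′ k n (begin
        e′ ℚ.* e    ≤⟨ *-monoˡ-≤ (fraction-nonNeg k′ n′) (ℚ.<⇒≤ (lower<upper (isReal p) e<p p<b)) ⟩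
        e′ ℚ.* b    ≤⟨ e′b≤c ⟩
        c           ≤⟨ ℚ.<⇒≤ c<1 ⟩
        1ℚ          ∎))
      where open ℚ.≤-Reasoning

-- Finite sums

-- Phrased with rational bounds because the terms are bare cuts, for which `≤` gives less; `All`
-- lets a term use what is known of its index.
lower-∑-list-≤ : {A : Set a} {f g : A → Cut 0ℓ} {xs : List A} →
  All (λ i → ∀ {s u} → lower (f i) s → upper (g i) u → s ℚ.≤ u) xs →
  lower (∑-list xs f) x → upper (∑-list xs g) y → x ℚ.≤ y
lower-∑-list-≤ [] x<0 0<y = ℚ.<⇒≤ (ℚ.<-trans x<0 0<y)
lower-∑-list-≤ (f≤g ∷ fs≤gs) (_ , _ , l , ls , x≤) (_ , _ , u , us , ≤y) =
  ℚ.≤-trans x≤ (ℚ.≤-trans (ℚ.+-mono-≤ (f≤g l u) (lower-∑-list-≤ fs≤gs ls us)) ≤y)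

upper-∑-filter-accept : {A : Set a} {P : Pred A c} (P? : Decidable P)
  {f : A → Cut 0ℓ} {i : A} (is : List A) →
  P i → upper (∑-list (filter P? (i ∷ is)) f) x → upper (f i + ∑-list (filter P? is) f) x
upper-∑-filter-accept P? is Pi = subst (λ js → upper (∑-list js _) _) (filter-accept P? Pi)

upper-∑-filter-reject : {A : Set a} {P : Pred A c} (P? : Decidable P)
  {f : A → Cut 0ℓ} {i : A} (is : List A) →
  ¬ P i → upper (∑-list (filter P? (i ∷ is)) f) x → upper (∑-list (filter P? is) f) x
upper-∑-filter-reject P? is ¬Pi = subst (λ js → upper (∑-list js _) _) (filter-reject P? ¬Pi)

-- Indicator functions of finite sets

module _ {X : Set} (_≟_ : DecidableEquality X) (W : List X) where

  open DecMembership _≟_ using (_∈?_)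
  open Algebra.Properties.CommutativeSemigroup
    (CommutativeRing.+-commutativeSemigroup ℚ.+-*-commutativeRing) using (x∙yz≈y∙xz)

  indicator : X → ℚ
  indicator x = if does (x ∈? W) then 1ℚ else 0ℚ

  indicatorℝ : X → ℝ
  indicatorℝ x = mkℝ (fromℚ (indicator x)) (fromℚ-isReal (indicator x))

  Crossing : X × X → Set
  Crossing (x , y) = x ∈ W × ¬ (y ∈ W)

  crossing? : Decidable Crossing
  crossing? (x , y) = (x ∈? W) ×-dec ¬? (y ∈? W)

  indicator-∈ : ∀ {x} → x ∈ W → indicator x ≡ 1ℚ
  indicator-∈ {x} x∈W with x ∈? W
  ... | yes _  = refl
  ... | no x∉W = contradiction x∈W x∉W

  indicator-∉ : ∀ {x} → x ∉ W → indicator x ≡ 0ℚ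
  indicator-∉ {x} x∉W with x ∈? W
  ... | yes x∈W = contradiction x∈W x∉W
  ... | no _    = refl

  ∣indicator-indicator∣≤1 : ∀ x y → ℚ.∣ indicator x ℚ.- indicator y ∣ ℚ.≤ 1ℚ
  ∣indicator-indicator∣≤1 x y with x ∈? W | y ∈? W
  ... | yes _ | yes _ = 0≤1
  ... | yes _ | no _  = ℚ.≤-refl
  ... | no _  | yes _ = ℚ.≤-refl
  ... | no _  | no _  = 0≤1

  ∣indicator-indicator∣≡0 : ∀ x y → ¬ Crossing (x , y) → ¬ Crossing (y , x) →
    ℚ.∣ indicator x ℚ.- indicator y ∣ ≡ 0ℚ
  ∣indicator-indicator∣≡0 x y ¬xy ¬yx with x ∈? W | y ∈? W
  ... | yes _   | yes _   = refl
  ... | yes x∈W | no y∉W  = contradiction (x∈W , y∉W) ¬xy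
  ... | no x∉W  | yes y∈W = contradiction (y∈W , x∉W) ¬yx
  ... | no _    | no _    = refl

  module _ {m : X → ℝ} (G : Graph X m) where
    open Graph G

    -- At a point of `W` the indicator is 1, so the summand is the weight itself. The norm is a
    -- denominator, so this direction bounds the quotient from above.
    measure≤norm : (∀ x → 𝟎 < cut (m x)) → (p : ℝ) →
      lower (measure (_∈ W)) x → upper (‖ indicatorℝ ‖[ p ] ^ cut p) y → x ℚ.≤ y
    measure≤norm m-positive p ((is , unique , is⊆W) , l) u
      with upper-^-root (∑ U (λ i → ∣ cut (indicatorℝ i) ∣ ^ cut p * cut (m i))) p
             (ℚ.<⇒≤ ∘ ∑-upper-pos) u
    ... | r , (s , s<r , bound) , r≤y = ℚ.≤-trans
      -- The same list, now regarded as a list in all of `X`, gives a partial sum of the norm.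
      (lower-∑-list-≤ (All.map (λ {i} → term i) is⊆W) l
        (bound (is , unique , All.universal-U is)))
      (ℚ.≤-trans (ℚ.<⇒≤ s<r) r≤y)
      where
      term : ∀ i → i ∈ W → ∀ {s u} → lower (cut (m i)) s →
        upper (∣ fromℚ (indicator i) ∣ ^ cut p * cut (m i)) u → s ℚ.≤ u
      term i i∈W {s} {u} l (α , μ , uα , uμ , αμ≤u) = begin
        s            ≤⟨ ℚ.<⇒≤ (lower<upper (isReal (m i)) l uμ) ⟩
        μ            ≡⟨ ℚ.*-identityˡ μ ⟨
        1ℚ ℚ.* μ     ≤⟨ *-monoʳ-≤ (pos⇒upper-nonNeg {α = m i} (m-positive i) uμ)
                         (1≤upper-^ (∣ cut (indicatorℝ i) ∣) (cut p) (λ (i<t , _) →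
                           ℚ.<⇒≤ (subst (ℚ._< _) (indicator-∈ i∈W) i<t)) uα) ⟩
        α ℚ.* μ      ≤⟨ αμ≤u ⟩
        u            ∎
        where open ℚ.≤-Reasoning

    -- Energy of the indicator against the weighted boundary

    module _ (d : X → X → ℝ) (d-nonNeg : ∀ x y → 𝟎 ≤ cut (d x y)) {t : ℚ} (0<t : 0ℚ ℚ.< t)
             (t<d : ∀ x y → 𝟎 < cut (b x y) → lower (cut (d x y)) t) (p : ℝ) where

      energyTerm boundaryTerm : X × X → Cut 0ℓ
      energyTerm (x , y) = cut (b x y) * ∣ cut (indicatorℝ x) - cut (indicatorℝ y) ∣ ^ cut p
      boundaryTerm (x , y) = cut (b x y) * cut (d x y)

      boundaryTerm-nonNeg : ∀ z {u} → upper (boundaryTerm z) u → 0ℚ ℚ.≤ u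
      boundaryTerm-nonNeg (x , y) (_ , _ , ub , ud , ≤u) =
        ℚ.≤-trans (*-nonNeg (upper-nonNeg (cut (b x y)) (nonnegative x y) ub)
          (upper-nonNeg (cut (d x y)) (d-nonNeg x y) ud)) ≤u

      -- The power of the difference is at most 1, and `t < d x′ y′` on an edge. The second pair is
      -- separate so that an edge entering `W` can be compared with its reversal, `d` not being
      -- symmetric.
      energyTerm≤boundaryTerm : ∀ x y x′ y′ → cut (b x y) ≤ cut (b x′ y′) → ∀ {s u} →
        lower (energyTerm (x , y)) s → upper (boundaryTerm (x′ , y′)) u → t ℚ.* s ℚ.≤ u
      energyTerm≤boundaryTerm x y x′ y′ b≤b′ {s} (inj₁ s<0) v = ℚ.≤-trans
        (subst (t ℚ.* s ℚ.≤_) (ℚ.*-zeroʳ t) (*-monoˡ-≤ (ℚ.<⇒≤ 0<t) (ℚ.<⇒≤ s<0)))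
        (boundaryTerm-nonNeg (x′ , y′) v)
      energyTerm≤boundaryTerm x y x′ y′ b≤b′ {s} {u}
        (inj₂ (β , α , (0≤β , lβ) , (0≤α , lα) , s≤βα)) (β′ , δ′ , uβ , uδ , β′δ′≤u) = begin
        t ℚ.* s              ≤⟨ *-monoˡ-≤ (ℚ.<⇒≤ 0<t) s≤βα ⟩
        t ℚ.* (β ℚ.* α)      ≤⟨ *-monoˡ-≤ (ℚ.<⇒≤ 0<t) (*-monoˡ-≤ 0≤β α≤1) ⟩
        t ℚ.* (β ℚ.* 1ℚ)     ≡⟨ cong (t ℚ.*_) (ℚ.*-identityʳ β) ⟩
        t ℚ.* β              ≡⟨ ℚ.*-comm t β ⟩
        β ℚ.* t              ≤⟨ *-mono-≤ 0≤β (ℚ.<⇒≤ (ℚ.<-trans 0<t t<δ′)) (ℚ.<⇒≤ β<β′) (ℚ.<⇒≤ t<δ′) ⟩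
        β′ ℚ.* δ′            ≤⟨ β′δ′≤u ⟩
        u                    ∎
        where
        open ℚ.≤-Reasoning
        lβ′ : lower (cut (b x′ y′)) β
        lβ′ = lower-transfer {α = b x y} {b x′ y′} b≤b′ lβ
        β<β′ : β ℚ.< β′
        β<β′ = lower<upper (isReal (b x′ y′)) lβ′ uβ
        -- The nonnegative lower bound `β` certifies that `b x′ y′` is positive, so `t<d` applies.
        t<δ′ : t ℚ.< δ′
        t<δ′ = lower<upper (isReal (d x′ y′)) (t<d x′ y′ (nonNeg-lower⇒pos {α = b x′ y′} 0≤β lβ′)) uδ
        α≤1 : α ℚ.≤ 1ℚ
        α≤1 = lower-^-≤1 (∣ cut (indicatorℝ x) - cut (indicatorℝ y) ∣) (cut p) (λ l → ℚ.<⇒≤ (ℚ.<-≤-trans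
          (lower-∣fromℚ-fromℚ∣ (indicator x) (indicator y) l) (∣indicator-indicator∣≤1 x y))) lα

      -- Both endpoints lie on the same side of `W`, so the difference is 0 and its power has only
      -- negative lower bounds.
      energyTerm≤0 : ∀ x y → ¬ Crossing (x , y) → ¬ Crossing (y , x) → ∀ {s} →
        lower (energyTerm (x , y)) s → s ℚ.≤ 0ℚ
      energyTerm≤0 x y ¬xy ¬yx (inj₁ s<0) = ℚ.<⇒≤ s<0
      energyTerm≤0 x y ¬xy ¬yx (inj₂ (_ , _ , _ , (0≤α , lα) , _)) =
        contradiction (ℚ.≤-<-trans 0≤α α<0) (ℚ.<-irrefl refl)
        where
        α<0 = lower-^-<0 (∣ cut (indicatorℝ x) - cut (indicatorℝ y) ∣) (cut p)
          (λ l → subst (_ ℚ.<_) (∣indicator-indicator∣≡0 x y ¬xy ¬yx)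
            (lower-∣fromℚ-fromℚ∣ (indicator x) (indicator y) l)) lα

      -- Pairs entering `W` are reversed, so both lists consist of elements of `∂W`.
      outward inward : List (X × X) → List (X × X)
      outward = filter crossing?
      inward  = filter crossing? ∘ map swap

      -- By induction on `zs`: a pair leaving `W` is charged to `u`, a pair entering it to `v`, and
      -- any other pair contributes nothing.
      energy≤boundary : ∀ zs {s u v} → lower (∑-list zs energyTerm) s →
        upper (∑-list (outward zs) boundaryTerm) u → upper (∑-list (inward zs) boundaryTerm) v →
        t ℚ.* s ℚ.≤ u ℚ.+ v
      energy≤boundary [] {s} {u} {v} s<0 0<u 0<v = begin
        t ℚ.* s     ≤⟨ *-monoˡ-≤ (ℚ.<⇒≤ 0<t) (ℚ.<⇒≤ s<0) ⟩
        t ℚ.* 0ℚ    ≡⟨ ℚ.*-zeroʳ t ⟩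
        0ℚ ℚ.+ 0ℚ   ≤⟨ ℚ.<⇒≤ (ℚ.+-mono-< 0<u 0<v) ⟩
        u ℚ.+ v     ∎
        where open ℚ.≤-Reasoning
      energy≤boundary ((x , y) ∷ zs) {s} {u} {v} (s₁ , s₂ , l₁ , l₂ , s≤) lu lv
        with crossing? (x , y) | crossing? (y , x)
      ... | yes (x∈W , _) | yes (_ , x∉W) = contradiction x∈W x∉W
      ... | yes xy | no ¬yx
        with u₁ , u₂ , lu₁ , lu₂ , ≤u ← upper-∑-filter-accept crossing? zs xy lu =
        *-distribˡ-+-≤ (ℚ.<⇒≤ 0<t) s≤
          (energyTerm≤boundaryTerm x y x y (≤-refl (b x y)) l₁ lu₁)
          (energy≤boundary zs l₂ lu₂ (upper-∑-filter-reject crossing? (map swap zs) ¬yx lv))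
          (subst (ℚ._≤ u ℚ.+ v) (ℚ.+-assoc u₁ u₂ v) (ℚ.+-monoˡ-≤ v ≤u))
      ... | no ¬xy | yes yx
        with v₁ , v₂ , lv₁ , lv₂ , ≤v ← upper-∑-filter-accept crossing? (map swap zs) yx lv =
        *-distribˡ-+-≤ (ℚ.<⇒≤ 0<t) s≤
          (energyTerm≤boundaryTerm x y y x (proj₁ (symmetric x y)) l₁ lv₁)
          (energy≤boundary zs l₂ (upper-∑-filter-reject crossing? zs ¬xy lu) lv₂)
          (subst (ℚ._≤ u ℚ.+ v) (x∙yz≈y∙xz u v₁ v₂) (ℚ.+-monoʳ-≤ u ≤v))
      ... | no ¬xy | no ¬yx =
        *-distribˡ-+-≤ (ℚ.<⇒≤ 0<t) s≤
          (subst (t ℚ.* s₁ ℚ.≤_) (ℚ.*-zeroʳ t)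
            (*-monoˡ-≤ (ℚ.<⇒≤ 0<t) (energyTerm≤0 x y ¬xy ¬yx l₁)))
          (energy≤boundary zs l₂ (upper-∑-filter-reject crossing? zs ¬xy lu)
            (upper-∑-filter-reject crossing? (map swap zs) ¬yx lv))
          (ℚ.≤-reflexive (ℚ.+-identityˡ (u ℚ.+ v)))

      -- Both lists are free of repetitions, so each of their sums lies below the same `r < y`, and
      -- the factor ½ turns `r + r` into `r`.
      energy<boundary : lower (energy p indicatorℝ) x → 0ℚ ℚ.≤ x →
        upper (boundary d (_∈ W)) y → t ℚ.* x ℚ.< y
      energy<boundary (inj₁ x<0) 0≤x _ =
        contradiction (ℚ.≤-<-trans 0≤x x<0) (ℚ.<-irrefl refl)
      energy<boundary {x} {y} (inj₂ (s , e , (_ , s<½) , (0≤e , (zs , unique , _) , le) , x≤se)) _ (r , r<y , bound) =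
        begin-strict
        t ℚ.* x              ≤⟨ *-monoˡ-≤ (ℚ.<⇒≤ 0<t) x≤se ⟩
        t ℚ.* (s ℚ.* e)      ≤⟨ *-monoˡ-≤ (ℚ.<⇒≤ 0<t) (*-monoʳ-≤ 0≤e (ℚ.<⇒≤ s<½)) ⟩
        t ℚ.* (½ ℚ.* e)      ≡⟨ solve 2 (λ t e → t :* (con ½ :* e) := con ½ :* (t :* e)) refl t e ⟩
        ½ ℚ.* (t ℚ.* e)      ≤⟨ *-monoˡ-≤ (from-yes (0ℚ ℚ.≤? ½)) (energy≤boundary zs le
                                  (bound (_ , filter⁺ crossing? unique , all-filter crossing? zs))
                                  -- `swap` undoes itself definitionally, so `cong swap` proves its
                                  -- injectivity.
                                  (bound (_ , filter⁺ crossing? (map⁺ (cong swap) unique)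
                                            , all-filter crossing? (map swap zs)))) ⟩
        ½ ℚ.* (r ℚ.+ r)      ≡⟨ solve 1 (λ r → con ½ :* (r :+ r) := r) refl r ⟩
        r                    <⟨ r<y ⟩
        y                    ∎
        where
        open ℚ.≤-Reasoning
        open +-*-Solver

-- The upper bound on the infimum of the quotients

theorem3p9 : (X : Set) (x₀ : X) (countable : X ↣ ℕ)
    (m : X → ℝ) (m-positive : ∀ x → 𝟎 < cut (m x))
    (G : Graph X m) → let open Graph G in
    (p : ℝ) → 𝟏 ≤ cut p →
    (d : X → X → ℝ) → (∀ x y → 𝟎 ≤ cut (d x y)) → 𝟎 < δ d →
    λ⁰ p ≤ h⁰ d / δ d
theorem3p9 X x₀ countable m m-positive G p 1≤p d d-nonNeg 0<δ
  -- That `q` exceeds the right side yields a set `W` with boundary below `β`, measure above `μ` and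
  -- `β ≤ s * μ`, and `0 < t < δ′` with `δ′` below `d` on every edge and `s ≤ q * t`. The number
  -- `q′ > q` lies below all quotients.
  (q , (s , t , ((W , W≢[]) , β , μ , uβ , (0<μ , lμ) , β≤sμ) , (0<t , δ′ , t<δ′ , lδ) , s≤qt)
     , (q′ , q<q′ , lλ)) = refute (lλ (φ , (W , φ-supported) , φ-nonzero W≢[]))
  where
  open Graph G

  -- Countability enters here, making membership in `W` decidable.
  _≟_ : DecidableEquality X
  _≟_ = via-injection countable ℕ._≟_

  φ : X → ℝ
  φ = indicatorℝ _≟_ W

  φ-supported : ∀ x → x ∉ W → cut (φ x) ≃ 𝟎
  φ-supported x x∉W = subst (λ y → fromℚ y ≃ 𝟎) (sym (indicator-∉ _≟_ W x∉W))
    (≤-refl (mkℝ 𝟎 (fromℚ-isReal 0ℚ)) , ≤-refl (mkℝ 𝟎 (fromℚ-isReal 0ℚ)))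

  φ-nonzero : W ≢ [] → Nonzero φ
  φ-nonzero W≢[] φ≃0 = W-empty W refl
    where
    -- As `φ` depends on `W`, the split is on a copy of it. At the head of a nonempty list `φ` is 1,
    -- and ½ separates this from 0.
    W-empty : ∀ W′ → W ≡ W′ → ⊥
    W-empty [] W≡[] = W≢[] W≡[]
    W-empty (x ∷ _) W≡x∷ = proj₁ (φ≃0 x) (½ , from-yes (0ℚ ℚ.<? ½) ,
      subst (½ ℚ.<_) (sym (indicator-∈ _≟_ W (subst (x ∈_) (sym W≡x∷) (here refl)))) (from-yes (½ ℚ.<? 1ℚ)))

  0<q : 0ℚ ℚ.< q
  -- Positivity passes from `β` to `s` and from `s` to `q`.
  0<q = positive-of-product (positive-of-product (∑-upper-pos uβ) (ℚ.<⇒≤ 0<μ) β≤sμ) (ℚ.<⇒≤ 0<t) s≤qt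

  refute : lower (energy p φ / ‖ φ ‖[ p ] ^ cut p) q′ → ⊥
  refute (inj₁ q′<0) = ℚ.<-asym 0<q (ℚ.<-trans q<q′ q′<0)
  -- Here `e` is below the energy and `n` above the power of the norm, so `q * μ ≤ q′ * n ≤ e`. The
  -- chain returns to its start with one strict step, the energy estimate.
  refute (inj₂ (e , n , le , un , q′n≤e)) = ℚ.<-irrefl refl (begin-strict
    q ℚ.* t ℚ.* μ        ≡⟨ solve 3 (λ q t μ → q :* t :* μ := t :* (q :* μ)) refl q t μ ⟩
    t ℚ.* (q ℚ.* μ)      ≤⟨ *-monoˡ-≤ (ℚ.<⇒≤ 0<t) qμ≤e ⟩
    t ℚ.* e              <⟨ energy<boundary _≟_ W G d d-nonNeg 0<t
                              (λ x y 0<b → IsReal.lower-closed (isReal (d x y)) t<δ′ (lδ ((x , y) , 0<b)))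
                              p le (ℚ.≤-trans (*-nonNeg (ℚ.<⇒≤ 0<q) (ℚ.<⇒≤ 0<μ)) qμ≤e) uβ ⟩
    β                    ≤⟨ β≤sμ ⟩
    s ℚ.* μ              ≤⟨ *-monoʳ-≤ (ℚ.<⇒≤ 0<μ) s≤qt ⟩
    q ℚ.* t ℚ.* μ        ∎)
    where
    open ℚ.≤-Reasoning
    open +-*-Solver
    μ≤n : μ ℚ.≤ n
    μ≤n = measure≤norm _≟_ W G m-positive p lμ un
    qμ≤e : q ℚ.* μ ℚ.≤ e
    qμ≤e = ℚ.≤-trans (*-mono-≤ (ℚ.<⇒≤ 0<q) (ℚ.≤-trans (ℚ.<⇒≤ 0<μ) μ≤n) (ℚ.<⇒≤ q<q′) μ≤n) q′n≤e
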